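{- Let $p\ge5$ and let $\rho$ be the rightmost assignment on the white metallic tree. For every node $\nu$ of $\mathcal W_\rho$, the integer whose nzm-code is the nzm-code of $\nu$ followed by the digit $1$ (the successor of $\nu$) is a son of $\nu$ in $\mathcal W_\rho$, and no other son of $\nu$ in $\mathcal W_\rho$ has an nzm-code ending with $1$. Moreover, $\rho$ is the unique assignment $\alpha$ such that, for every node $\nu$, the successor of $\nu$ is a son of $\nu$ in $\mathcal W_\alpha$.
   Context: Fix $p\ge5$. Metallic numbers: $m_{ -1}=0$, $m_0=1$, $m_{n+2}=(p-2)m_{n+1}-m_n$. With $x=p-2$, $d=p-3$, the nzm-code of a positive integer $n$ is the unique word $a_k\cdots a_0$ over $\{1,\dots,p-2\}$ with $n=\sum a_im_i$ containing no factor $x\,d^j\,x$ ($j\ge0$). White metallic tree under an assignment $\alpha$, $\mathcal W_\alpha$: nodes are the positive integers, each black or white; root $1$ is white; nodes are processed in increasing order, node $\nu$ receives $p-2$ sons if white and $p-3$ sons if black, namely the smallest integers not yet used, in increasing order; an assignment specifies for each node the position (leftmost $=1$) of its unique black son among its sons, other sons being white. The rightmost assignment $\rho$ always puts the black son at the last position. -}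

module Defs where

open import Data.Bool using (if_then_else_)
open import Data.List using (List; []; _∷_; [_]; _++_; _∷ʳ_; length; replicate)
open import Data.List.Relation.Unary.All using (All)
open import Data.Nat using (ℕ; zero; suc; pred; _+_; _*_; _∸_; _≤_; z≤n; s≤s; _≟_)
open import Data.Nat.Properties using (≤-trans; ≤-reflexive; ∸-monoˡ-≤)
open import Data.List.Membership.DecPropositional _≟_ using (_∈?_)
open import Data.Product using (_×_; _,_; ∃-syntax)
open import Relation.Binary.PropositionalEquality
  using (_≡_; refl; sym; cong)
open import Relation.Nullary using (¬_; does)

module Metallic (p : ℕ) (5≤p : 5 ≤ p) where

  x d : ℕ
  x = p ∸ 2
  d = p ∸ 3

  -- The sequence starts at index -1, so  shifted k  is m_{k-1}.  It is
  -- increasing for p ≥ 5, hence the monus below never truncates.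
  shifted : ℕ → ℕ
  shifted zero          = 0
  shifted (suc zero)    = 1
  shifted (suc (suc k)) = (p ∸ 2) * shifted (suc k) ∸ shifted k

  m : ℕ → ℕ
  m n = shifted (suc n)

  -- Words are written as on paper, a_k ∷ … ∷ a_0 ∷ [].
  Word : Set
  Word = List ℕ

  value : Word → ℕ
  value []      = 0
  value (a ∷ w) = a * m (length w) + value w

  Digit : ℕ → Set
  Digit a = 1 ≤ a × a ≤ p ∸ 2

  HasForbiddenFactor : Word → Set
  HasForbiddenFactor w =
    ∃[ u ] ∃[ j ] ∃[ v ] w ≡ u ++ (x ∷ replicate j d ++ [ x ]) ++ v

  Represents : Word → ℕ → Set
  Represents w n = All Digit w × n ≡ value w × ¬ HasForbiddenFactor w

  -- The definite description "the unique word" is part of the definition.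
  IsNzmCode : Word → ℕ → Set
  IsNzmCode w n = Represents w n × (∀ w′ → Represents w′ n → w′ ≡ w)

  IsSuccessor : ℕ → ℕ → Set
  IsSuccessor ν s = ∃[ w ] IsNzmCode w ν × IsNzmCode (w ∷ʳ 1) s

  CodeEndsWithOne : ℕ → Set
  CodeEndsWithOne n = ∃[ w ] IsNzmCode (w ∷ʳ 1) n

  data Colour : Set where
    white black : Colour

  arity : Colour → ℕ
  arity white = p ∸ 2
  arity black = p ∸ 3

  -- The state of the construction: the integers used so far are 1, …, used,
  -- and those among them that are not listed in blacks are white.
  record Stage : Set where
    constructor stage
    field
      used   : ℕ
      blacks : List ℕ

  open Stage public

  colourIn : Stage → ℕ → Colour
  colourIn S ν = if does (ν ∈? blacks S) then black else white

  start : Stage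
  start = stage 1 []

  -- Process node ν, its black son being put at position i.
  step : (ν i : ℕ) → Stage → Stage
  step ν i S = stage (used S + arity (colourIn S ν)) (used S + i ∷ blacks S)

  -- The state once the nodes 1, …, n have been processed.
  after : (ℕ → ℕ) → ℕ → Stage
  after f zero    = start
  after f (suc n) = step (suc n) (f (suc n)) (after f n)

  -- The state just before a node ν ≥ 1 is processed.
  before : (ℕ → ℕ) → ℕ → Stage
  before f ν = after f (pred ν)

  colour : (ℕ → ℕ) → ℕ → Colour
  colour f ν = colourIn (before f ν) ν

  -- The nodes are the integers ν ≥ 1; the value of position at 0 is irrelevant.
  -- The admissible positions at ν depend on the colour of ν, which itself
  -- depends on the positions chosen at smaller nodes.
  record Assignment : Set where
    field
      position : ℕ → ℕ
      valid    : ∀ ν → 1 ≤ ν →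
                 1 ≤ position ν × position ν ≤ arity (colour position ν)

  open Assignment public

  IsSonOf : Assignment → ℕ → ℕ → Set
  IsSonOf α μ ν =
    ∃[ i ] 1 ≤ i × i ≤ arity (colour (position α) ν)
         × μ ≡ used (before (position α) ν) + i

  SuccessorsAreSons : Assignment → Set
  SuccessorsAreSons α = ∀ ν → 1 ≤ ν → ∃[ s ] IsSuccessor ν s × IsSonOf α s ν

  -- The rightmost assignment is built together with its tree, since the last
  -- position at a node depends on the colour of that node.
  afterʳ : ℕ → Stage
  afterʳ zero    = start
  afterʳ (suc n) = step (suc n) (arity (colourIn (afterʳ n) (suc n))) (afterʳ n)

  lastPosition : ℕ → ℕ
  lastPosition ν = arity (colourIn (afterʳ (pred ν)) ν)

  after-lastPosition : ∀ n → after lastPosition n ≡ afterʳ n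
  after-lastPosition zero    = refl
  after-lastPosition (suc n) =
    cong (step (suc n) (lastPosition (suc n))) (after-lastPosition n)

  lastPosition-isLast : ∀ ν → lastPosition ν ≡ arity (colour lastPosition ν)
  lastPosition-isLast ν =
    cong (λ S → arity (colourIn S ν)) (sym (after-lastPosition (pred ν)))

  1≤arity : ∀ c → 1 ≤ arity c
  1≤arity white = ≤-trans (s≤s z≤n) (∸-monoˡ-≤ 2 5≤p)
  1≤arity black = ≤-trans (s≤s z≤n) (∸-monoˡ-≤ 3 5≤p)

  ρ : Assignment
  ρ = record
    { position = lastPosition
    ; valid    = λ ν _ → 1≤arity (colourIn (afterʳ (pred ν)) ν)
                       , ≤-reflexive (lastPosition-isLast ν)
    }

{-# OPTIONS --safe #-}
-- Read words from the units digit upwards.  Incrementing an admissible word w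
-- raises its value by 1, and raises the value of w shifted by one place by
-- the largest digit  top w  that may follow w.  Hence the successor σ n of n
-- satisfies  σ (n + 1) = σ n + top (code n),  which is the recursion for the
-- last son in the rightmost tree, as top (code n) is p − 3 exactly when n + 1
-- is itself a successor.  If an assignment first leaves the last position at
-- some node, it agrees with the rightmost tree below the misplaced black son,
-- which then has one son too few to reach its successor.
module Submission where

open import Defs
open import Data.Empty using (⊥; ⊥-elim)
open import Data.List using ([]; _∷_; [_]; _++_; _∷ʳ_; length; replicate; reverse)
open import Data.List.Membership.Propositional using (_∈_)
open import Data.List.Properties
  using (unfold-reverse; reverse-++; reverse-involutive; length-reverse; ++-assoc; ∷-injectiveˡ; ∷-injectiveʳ)
open import Data.List.Relation.Unary.All using (All; []; _∷_)
open import Data.List.Relation.Binary.Permutation.Propositional using (↭-sym)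
open import Data.List.Relation.Binary.Permutation.Propositional.Properties using (All-resp-↭; ↭-reverse)
open import Data.List.Relation.Unary.Any using (here; there)
open import Data.Nat
  using (ℕ; zero; suc; _+_; _*_; _∸_; _≤_; _<_; _≤′_; ≤′-refl; ≤′-step; z≤n; s≤s; s≤s⁻¹; _≟_)
open import Data.Nat.Properties
open import Data.List.Membership.DecPropositional _≟_ using (_∈?_)
open import Data.Product using (_×_; _,_; proj₁; proj₂; ∃-syntax)
open import Data.Sum using (_⊎_; inj₁; inj₂; [_,_]′)
open import Data.Nat.Tactic.RingSolver using (solve-∀)
open import Function using (_∘_)
open import Relation.Binary.PropositionalEquality hiding ([_])
open import Relation.Nullary using (¬_; yes; no)
open import Relation.Nullary.Decidable using (dec-true; dec-false)

-- List reversal.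

reverse-replicate : ∀ {A : Set} n (a : A) → reverse (replicate n a) ≡ replicate n a
reverse-replicate zero    a = refl
reverse-replicate (suc n) a = begin
  reverse (a ∷ replicate n a)  ≡⟨ unfold-reverse a (replicate n a) ⟩
  reverse (replicate n a) ∷ʳ a ≡⟨ cong (_∷ʳ a) (reverse-replicate n a) ⟩
  replicate n a ∷ʳ a           ≡⟨ replicate-∷ʳ n ⟩
  a ∷ replicate n a            ∎
  where
  open ≡-Reasoning
  replicate-∷ʳ : ∀ n → replicate n a ∷ʳ a ≡ a ∷ replicate n a
  replicate-∷ʳ zero    = refl
  replicate-∷ʳ (suc n) = cong (a ∷_) (replicate-∷ʳ n)

All-reverse : ∀ {A : Set} {P : A → Set} {as} → All P as → All P (reverse as)
All-reverse {as = as} = All-resp-↭ (↭-sym (↭-reverse as))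

module Rightmost (p : ℕ) (5≤p : 5 ≤ p) where

  open Metallic p 5≤p

  -- Digit bounds and the metallic recurrence.

  x≡1+d : x ≡ suc d
  x≡1+d = +-∸-assoc 1 {p} {3} (≤-trans (s≤s (s≤s (s≤s z≤n))) 5≤p)

  2≤d : 2 ≤ d
  2≤d = ∸-monoˡ-≤ 3 5≤p

  d<x : d < x
  d<x = ≤-reflexive (sym x≡1+d)

  2≤x : 2 ≤ x
  2≤x = ≤-trans 2≤d (<⇒≤ d<x)

  shifted-mono : ∀ k → shifted k ≤ shifted (suc k)
  shifted-mono zero    = z≤n
  shifted-mono (suc k) = begin
    shifted (suc k)                            ≡⟨ m+n∸n≡m (shifted (suc k)) (shifted k) ⟨
    shifted (suc k) + shifted k ∸ shifted k    ≤⟨ ∸-monoˡ-≤ (shifted k) bound ⟩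
    x * shifted (suc k) ∸ shifted k            ∎
    where
    open ≤-Reasoning
    bound : shifted (suc k) + shifted k ≤ x * shifted (suc k)
    bound = begin
      shifted (suc k) + shifted k               ≤⟨ +-monoʳ-≤ _ (shifted-mono k) ⟩
      shifted (suc k) + shifted (suc k)         ≡⟨ cong (shifted (suc k) +_) (+-identityʳ _) ⟨
      2 * shifted (suc k)                       ≤⟨ *-monoˡ-≤ (shifted (suc k)) 2≤x ⟩
      x * shifted (suc k)                       ∎

  -- Monotonicity ensures that the subtraction defining `shifted` does not truncate.
  shifted-recurrence : ∀ k → shifted (2 + k) + shifted k ≡ x * shifted (suc k)
  shifted-recurrence k = m∸n+n≡m (≤-trans (shifted-mono k)
    (≤-trans (≤-reflexive (sym (*-identityˡ _))) (*-monoˡ-≤ (shifted (suc k)) (≤-trans (s≤s z≤n) 2≤x))))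

  -- Evaluation of words.

  -- Words are little-endian from here on: the units digit has weight shifted k,
  -- so that eval 1 is the value and eval 2 the value after a shift by one place.
  eval : ℕ → Word → ℕ
  eval k []      = 0
  eval k (a ∷ w) = a * shifted k + eval (suc k) w

  eval-∷ʳ : ∀ k w a → eval k (w ∷ʳ a) ≡ eval k w + a * shifted (length w + k)
  eval-∷ʳ k []      a = +-identityʳ _
  eval-∷ʳ k (b ∷ w) a = begin
    b * shifted k + eval (suc k) (w ∷ʳ a)
      ≡⟨ cong (b * shifted k +_) (eval-∷ʳ (suc k) w a) ⟩
    b * shifted k + (eval (suc k) w + a * shifted (length w + suc k))
      ≡⟨ +-assoc (b * shifted k) _ _ ⟨
    b * shifted k + eval (suc k) w + a * shifted (length w + suc k)
      ≡⟨ cong (λ l → b * shifted k + eval (suc k) w + a * shifted l) (+-suc (length w) k) ⟩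
    b * shifted k + eval (suc k) w + a * shifted (suc (length w + k)) ∎
    where open ≡-Reasoning

  value≡eval : ∀ w → value w ≡ eval 1 (reverse w)
  value≡eval []      = refl
  value≡eval (a ∷ w) = begin
    a * shifted (suc (length w)) + value w
      ≡⟨ +-comm _ (value w) ⟩
    value w + a * shifted (suc (length w))
      ≡⟨ cong₂ (λ v l → v + a * shifted l) (value≡eval w)
           (trans (+-comm 1 (length w)) (cong (_+ 1) (sym (length-reverse w)))) ⟩
    eval 1 (reverse w) + a * shifted (length (reverse w) + 1)
      ≡⟨ eval-∷ʳ 1 (reverse w) a ⟨
    eval 1 (reverse w ∷ʳ a)
      ≡⟨ cong (eval 1) (unfold-reverse a w) ⟨
    eval 1 (reverse (a ∷ w)) ∎
    where open ≡-Reasoning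

  value-reverse : ∀ w → value (reverse w) ≡ eval 1 w
  value-reverse w = trans (value≡eval (reverse w)) (cong (eval 1) (reverse-involutive w))

  -- `eval` is linear in the weights, so it inherits their recurrence.
  eval-recurrence : ∀ k w → eval (2 + k) w + eval k w ≡ x * eval (suc k) w
  eval-recurrence k []      = sym (*-zeroʳ x)
  eval-recurrence k (a ∷ w) = begin
    (a * shifted (2 + k) + eval (3 + k) w) + (a * shifted k + eval (suc k) w)
      ≡⟨ regroup a (shifted (2 + k)) (eval (3 + k) w) (shifted k) (eval (suc k) w) ⟩
    a * (shifted (2 + k) + shifted k) + (eval (3 + k) w + eval (suc k) w)
      ≡⟨ cong₂ (λ s e → a * s + e) (shifted-recurrence k) (eval-recurrence (suc k) w) ⟩
    a * (x * shifted (suc k)) + x * eval (2 + k) w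
      ≡⟨ factor a x (shifted (suc k)) (eval (2 + k) w) ⟩
    x * (a * shifted (suc k) + eval (2 + k) w) ∎
    where
    open ≡-Reasoning
    regroup : ∀ a s e t f → (a * s + e) + (a * t + f) ≡ a * (s + t) + (e + f)
    regroup = solve-∀
    factor : ∀ a y s e → a * (y * s) + y * e ≡ y * (a * s + e)
    factor = solve-∀

  eval-shift : ∀ a w → eval 2 (a ∷ w) + eval 1 w ≡ x * eval 1 (a ∷ w)
  eval-shift a w = trans
    -- In `eval 0` the units digit has weight `shifted 0`, which is 0, so only `eval 1 w` remains.
    (cong (λ z → eval 2 (a ∷ w) + (z + eval 1 w)) (sym (*-zeroʳ a)))
    (eval-recurrence 0 (a ∷ w))

  -- Admissible words and forbidden factors.

  -- The largest digit that may follow w: it is d when w ends, in the order of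
  -- the paper, with x d^j.  On admissible words this happens exactly when the
  -- last digit is itself the largest one allowed.
  top : Word → ℕ
  top []      = x
  top (a ∷ w) with a ≟ top w
  ... | yes _ = d
  ... | no  _ = x

  -- A digit-by-digit form of the absence of forbidden factors, suited to induction and to counting.
  data Admissible : Word → Set where
    []  : Admissible []
    ext : ∀ {a w} → 1 ≤ a → a ≤ top w → Admissible w → Admissible (a ∷ w)

  top-cases : ∀ w → top w ≡ x ⊎ (top w ≡ d × ∃[ j ] ∃[ v ] w ≡ replicate j d ++ x ∷ v)
  top-cases []      = inj₁ refl
  top-cases (a ∷ w) with a ≟ top w
  ... | no  _    = inj₁ refl
  ... | yes refl with top-cases w
  ...   | inj₁ e           = inj₂ (refl , 0 , w , cong (_∷ w) e)
  ...   | inj₂ (e , j , v , e′) = inj₂ (refl , suc j , v , cong₂ _∷_ e e′)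

  top≤x : ∀ w → top w ≤ x
  top≤x w with top-cases w
  ... | inj₁ e       = ≤-reflexive e
  ... | inj₂ (e , _) = ≤-trans (≤-reflexive e) (<⇒≤ d<x)

  2≤top : ∀ w → 2 ≤ top w
  2≤top w with top-cases w
  ... | inj₁ e       = ≤-trans 2≤x (≤-reflexive (sym e))
  ... | inj₂ (e , _) = ≤-trans 2≤d (≤-reflexive (sym e))

  top-∷ : ∀ {a w} → a ≡ top w → top (a ∷ w) ≡ d
  top-∷ {a} {w} e with a ≟ top w
  ... | yes _ = refl
  ... | no ≢  = ⊥-elim (≢ e)

  -- Admissibility forces `x` to be the largest digit allowed over `v`, so the top drops to `d`;
  -- each further `d` is again the largest allowed and keeps it there.
  top-block : ∀ j v → Admissible (replicate j d ++ x ∷ v) → top (replicate j d ++ x ∷ v) ≡ d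
  top-block zero    v (ext _ x≤ _) = top-∷ (≤-antisym x≤ (top≤x v))
  top-block (suc j) v (ext _ _ A)  = top-∷ {w = replicate j d ++ x ∷ v} (sym (top-block j v A))

  admissible⇒¬forbidden : ∀ {w} → Admissible w → ¬ HasForbiddenFactor w
  admissible⇒¬forbidden A (b ∷ u , j , v , refl) with A
  ... | ext _ _ A′ = admissible⇒¬forbidden A′ (u , j , v , refl)
  admissible⇒¬forbidden A ([] , j , v , refl) with A
  ... | ext _ x≤ A′ rewrite ++-assoc (replicate j d) [ x ] v =
    <⇒≱ d<x (≤-trans x≤ (≤-reflexive (top-block j v A′)))

  admissible⇒digits : ∀ {w} → Admissible w → All Digit w
  admissible⇒digits []                  = []
  admissible⇒digits (ext {w = w} l u A) = (l , ≤-trans u (top≤x w)) ∷ admissible⇒digits A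

  ¬forbidden⇒admissible : ∀ {w} → All Digit w → ¬ HasForbiddenFactor w → Admissible w
  ¬forbidden⇒admissible []                               ¬F = []
  ¬forbidden⇒admissible (_∷_ {a} {w} (1≤a , a≤x) D) ¬F =
    ext 1≤a a≤top (¬forbidden⇒admissible D λ { (u , j , v , e) → ¬F (a ∷ u , j , v , cong (a ∷_) e) })
    where
    a≤top : a ≤ top w
    a≤top with top-cases w
    ... | inj₁ e = ≤-trans a≤x (≤-reflexive (sym e))
    ... | inj₂ (e , j , v , e′) = ≤-trans (s≤s⁻¹ (≤-trans (≤∧≢⇒< a≤x a≢x) (≤-reflexive x≡1+d))) (≤-reflexive (sym e))
      where
      -- A digit `x` here would complete a forbidden factor with the block supplied by `top-cases`.
      a≢x : a ≢ x
      a≢x a≡x = ¬F ([] , j , v , cong₂ _∷_ a≡x (trans e′ (sym (++-assoc (replicate j d) [ x ] v))))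

  -- The forbidden factors are palindromes.
  forbidden-reverse : ∀ {w} → HasForbiddenFactor w → HasForbiddenFactor (reverse w)
  forbidden-reverse (u , j , v , refl) = reverse v , j , reverse u , (begin
    reverse (u ++ block ++ v)                     ≡⟨ reverse-++ u (block ++ v) ⟩
    reverse (block ++ v) ++ reverse u             ≡⟨ cong (_++ reverse u) (reverse-++ block v) ⟩
    (reverse v ++ reverse block) ++ reverse u     ≡⟨ ++-assoc (reverse v) _ _ ⟩
    reverse v ++ reverse block ++ reverse u       ≡⟨ cong (λ b → reverse v ++ b ++ reverse u) palindrome ⟩
    reverse v ++ block ++ reverse u               ∎)
    where
    open ≡-Reasoning
    block : Word
    block = x ∷ replicate j d ++ [ x ]
    palindrome : reverse block ≡ block
    palindrome = begin
      reverse (x ∷ replicate j d ++ [ x ])     ≡⟨ unfold-reverse x (replicate j d ++ [ x ]) ⟩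
      reverse (replicate j d ++ [ x ]) ∷ʳ x    ≡⟨ cong (_∷ʳ x) (reverse-++ (replicate j d) [ x ]) ⟩
      x ∷ reverse (replicate j d) ∷ʳ x         ≡⟨ cong (λ r → x ∷ r ∷ʳ x) (reverse-replicate j d) ⟩
      x ∷ replicate j d ∷ʳ x                   ∎

  -- Incrementing a word.

  next : Word → Word
  next []      = [ 1 ]
  next (a ∷ w) with a ≟ top w
  ... | yes _ = 1 ∷ next w
  ... | no  _ = suc a ∷ w

  next-top : ∀ {a w} → a ≡ top w → next (a ∷ w) ≡ 1 ∷ next w
  next-top {a} {w} e with a ≟ top w
  ... | yes _ = refl
  ... | no ≢  = ⊥-elim (≢ e)

  next-<top : ∀ {a w} → a < top w → next (a ∷ w) ≡ suc a ∷ w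
  next-<top {a} {w} a<t with a ≟ top w
  ... | yes e = ⊥-elim (<⇒≢ a<t e)
  ... | no _  = refl

  next-admissible : ∀ {w} → Admissible w → Admissible (next w)
  next-admissible [] = ext ≤-refl (<⇒≤ 2≤x) []
  next-admissible (ext {a} {w} l u A) with a ≟ top w
  ... | yes _ = ext ≤-refl (<⇒≤ (2≤top (next w))) (next-admissible A)
  ... | no ≢  = ext (s≤s z≤n) (≤∧≢⇒< u ≢) A

  -- On a carry the units digit falls from `top w` to 1, while the higher digits contribute `top w`
  -- more by `shift-next`; the net gain is 1.
  eval-next  : ∀ {w} → Admissible w → eval 1 (next w) ≡ suc (eval 1 w)
  -- By `eval-shift`, the shifted value is `x` times the value minus the value of the higher digits.
  -- The value grows by 1; on a carry the higher digits grow by 1 as well, which leaves a gain of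
  -- `x` minus 1, that is `d`.
  shift-next : ∀ {w} → Admissible w → eval 2 (next w) ≡ eval 2 w + top w

  eval-next [] = refl
  eval-next (ext {a} {w} l u A) with a ≟ top w
  ... | no _  = refl
  ... | yes e = cong suc (begin
    eval 2 (next w)      ≡⟨ shift-next A ⟩
    eval 2 w + top w     ≡⟨ +-comm (eval 2 w) (top w) ⟩
    top w + eval 2 w     ≡⟨ cong (_+ eval 2 w) (trans (*-identityʳ a) e) ⟨
    a * 1 + eval 2 w     ∎)
    where open ≡-Reasoning

  -- The shifted value goes from 0 to `m 1`, which is `x`.
  shift-next [] = trans (+-identityʳ _) (trans (*-identityˡ _) (*-identityʳ _))
  shift-next (ext {a} {w} l u A) with a ≟ top w | eval-next (ext l u A)
  ... | yes _ | e = +-cancelʳ-≡ (suc (eval 1 w)) _ _ (begin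
    eval 2 (1 ∷ next w) + suc (eval 1 w)     ≡⟨ cong (eval 2 (1 ∷ next w) +_) (eval-next A) ⟨
    eval 2 (1 ∷ next w) + eval 1 (next w)    ≡⟨ eval-shift 1 (next w) ⟩
    x * eval 1 (1 ∷ next w)                  ≡⟨ cong (x *_) e ⟩
    x * suc (eval 1 (a ∷ w))                 ≡⟨ *-suc x _ ⟩
    x + x * eval 1 (a ∷ w)                   ≡⟨ cong₂ _+_ x≡1+d (sym (eval-shift a w)) ⟩
    suc d + (eval 2 (a ∷ w) + eval 1 w)      ≡⟨ rearrange d (eval 2 (a ∷ w)) (eval 1 w) ⟩
    eval 2 (a ∷ w) + d + suc (eval 1 w)      ∎)
    where
    open ≡-Reasoning
    rearrange : ∀ e s v → suc e + (s + v) ≡ s + e + suc v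
    rearrange = solve-∀
  ... | no _ | e = +-cancelʳ-≡ (eval 1 w) _ _ (begin
    eval 2 (suc a ∷ w) + eval 1 w            ≡⟨ eval-shift (suc a) w ⟩
    x * suc (eval 1 (a ∷ w))                 ≡⟨ *-suc x _ ⟩
    x + x * eval 1 (a ∷ w)                   ≡⟨ cong (x +_) (eval-shift a w) ⟨
    x + (eval 2 (a ∷ w) + eval 1 w)          ≡⟨ rearrange x (eval 2 (a ∷ w)) (eval 1 w) ⟩
    eval 2 (a ∷ w) + x + eval 1 w            ∎)
    where
    open ≡-Reasoning
    rearrange : ∀ e s v → e + (s + v) ≡ s + e + v
    rearrange = solve-∀

  -- The form `1 ∷ next v` says that the number reached is the successor of a positive integer.
  -- Allowing any tail after the 1 would include the word of 1, whose tail is empty, although the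
  -- root is white.
  carry-cases : ∀ {w} → Admissible w →
    (top w ≡ x × (∀ v → next w ≢ 1 ∷ next v)) ⊎
    (top w ≡ d × ∃[ v ] Admissible v × next w ≡ 1 ∷ next v)
  carry-cases [] = inj₁ (refl , λ v e → next≢[] v (sym (∷-injectiveʳ e)))
    where
    next≢[] : ∀ v → next v ≢ []
    next≢[] []      ()
    next≢[] (b ∷ v) e with b ≟ top v
    next≢[] (b ∷ v) () | yes _
    next≢[] (b ∷ v) () | no _
  carry-cases (ext {a} {w} l u A) with a ≟ top w
  ... | yes _ = inj₂ (refl , w , A , refl)
  -- Without a carry the units digit becomes `suc a`, which exceeds 1.
  ... | no _  = inj₁ (refl , λ v e → <⇒≢ l (sym (suc-injective (∷-injectiveˡ e))))

  -- Enumeration and uniqueness of codes.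

  code : ℕ → Word
  code zero    = []
  code (suc n) = next (code n)

  code-admissible : ∀ n → Admissible (code n)
  code-admissible zero    = []
  code-admissible (suc n) = next-admissible (code-admissible n)

  eval-code : ∀ n → eval 1 (code n) ≡ n
  eval-code zero    = refl
  eval-code (suc n) = trans (eval-next (code-admissible n)) (cong suc (eval-code n))

  -- Over a fixed `code n` the enumeration runs through the units digits from 1 to the top, then
  -- carries to 1 over `code (suc n)`.
  1∷code-reached : ∀ n → ∃[ k ] code k ≡ 1 ∷ code n
  ∷code-reached  : ∀ n a → suc a ≤ top (code n) → ∃[ k ] code k ≡ suc a ∷ code n

  1∷code-reached zero    = 1 , refl
  1∷code-reached (suc n) with top (code n) in e | 2≤top (code n)
  -- `suc t` is the top over `code n`, so the next increment carries.
  ... | suc t | _ with k , e′ ← ∷code-reached n t (≤-reflexive (sym e)) =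
    suc k , trans (cong next e′) (next-top (sym e))

  ∷code-reached n zero    _  = 1∷code-reached n
  ∷code-reached n (suc a) a< with k , e ← ∷code-reached n a (<⇒≤ a<) =
    suc k , trans (cong next e) (next-<top a<)

  code-surjective : ∀ {w} → Admissible w → ∃[ k ] code k ≡ w
  code-surjective [] = 0 , refl
  code-surjective (ext {suc a} _ u A) with code-surjective A
  ... | n , refl = ∷code-reached n a u

  -- Surjectivity gives uniqueness: an admissible word is `code k` for some `k`, and its value
  -- recovers `k`.
  code-eval : ∀ {w} → Admissible w → code (eval 1 w) ≡ w
  code-eval A with code-surjective A
  ... | k , refl = cong code (eval-code k)

  represents⇒code : ∀ {w n} → Represents w n → reverse w ≡ code n
  represents⇒code {w} (D , refl , ¬F) = begin
    reverse w                      ≡⟨ code-eval admissible ⟨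
    code (eval 1 (reverse w))      ≡⟨ cong code (value≡eval w) ⟨
    code (value w)                 ∎
    where
    open ≡-Reasoning
    admissible : Admissible (reverse w)
    admissible = ¬forbidden⇒admissible (All-reverse D)
      (¬F ∘ subst HasForbiddenFactor (reverse-involutive w) ∘ forbidden-reverse)

  code-represents : ∀ n → Represents (reverse (code n)) n
  code-represents n =
      All-reverse (admissible⇒digits (code-admissible n))
    , sym (trans (value-reverse (code n)) (eval-code n))
    , λ F → admissible⇒¬forbidden (code-admissible n)
        (subst HasForbiddenFactor (reverse-involutive (code n)) (forbidden-reverse F))

  code-isNzmCode : ∀ n → IsNzmCode (reverse (code n)) n
  code-isNzmCode n = code-represents n , λ w′ R →
    trans (sym (reverse-involutive w′)) (cong reverse (represents⇒code R))

  -- The successor function.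

  σ : ℕ → ℕ
  σ n = eval 1 (1 ∷ code n)

  code-σ : ∀ n → code (σ n) ≡ 1 ∷ code n
  code-σ n = code-eval (ext ≤-refl (<⇒≤ (2≤top (code n))) (code-admissible n))

  σ-suc : ∀ n → σ (suc n) ≡ σ n + top (code n)
  σ-suc n = cong suc (shift-next (code-admissible n))

  σ<σ-suc : ∀ n → σ n < σ (suc n)
  σ<σ-suc n = begin-strict
    σ n                   <⟨ m<m+n (σ n) (<⇒≤ (2≤top (code n))) ⟩
    σ n + top (code n)    ≡⟨ σ-suc n ⟨
    σ (suc n)             ∎
    where open ≤-Reasoning

  σ-mono-≤ : ∀ {i j} → i ≤ j → σ i ≤ σ j
  σ-mono-≤ = go ∘ ≤⇒≤′
    where
    go : ∀ {i j} → i ≤′ j → σ i ≤ σ j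
    go ≤′-refl             = ≤-refl
    go (≤′-step {n = j} q) = ≤-trans (go q) (<⇒≤ (σ<σ-suc j))

  σ-gap : ∀ {n} j → σ n < σ j → σ j < σ (suc n) → ⊥
  σ-gap {n} j n< <1+n with ≤-total j n
  ... | inj₁ j≤n = <⇒≱ n< (σ-mono-≤ j≤n)
  ... | inj₂ n≤j with m≤n⇒m<n∨m≡n n≤j
  ...   | inj₁ n<j  = <⇒≱ <1+n (σ-mono-≤ n<j)
  ...   | inj₂ refl = <-irrefl refl n<

  n<σ : ∀ n → n < σ n
  n<σ zero    = s≤s z≤n
  n<σ (suc n) = ≤-<-trans (n<σ n) (σ<σ-suc n)

  σ-isSuccessor : ∀ n → IsSuccessor n (σ n)
  σ-isSuccessor n = reverse (code n) , code-isNzmCode n ,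
    subst (λ w → IsNzmCode w (σ n))
      (trans (cong reverse (code-σ n)) (unfold-reverse 1 (code n)))
      (code-isNzmCode (σ n))

  isSuccessor⇒σ : ∀ {n s} → IsSuccessor n s → s ≡ σ n
  isSuccessor⇒σ {n} (w , (R , _) , (_ , refl , _) , _) = begin
    value (w ∷ʳ 1)                 ≡⟨ value≡eval (w ∷ʳ 1) ⟩
    eval 1 (reverse (w ∷ʳ 1))      ≡⟨ cong (eval 1) (reverse-++ w [ 1 ]) ⟩
    eval 1 (1 ∷ reverse w)         ≡⟨ cong (λ v → eval 1 (1 ∷ v)) (represents⇒code R) ⟩
    σ n                            ∎
    where open ≡-Reasoning

  -- The witness may be 0, since the code of 1 is a lone digit 1.
  endsWithOne⇒σ : ∀ {n} → CodeEndsWithOne n → ∃[ j ] n ≡ σ j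
  endsWithOne⇒σ {n} (w , R , _) with code n | code-admissible n | eval-code n | represents⇒code R
  ... | c | A | v | e with trans (sym (reverse-++ w [ 1 ])) e
  ...   | refl with ext _ _ A′ ← A with j , e′ ← code-surjective A′ =
    j , trans (sym v) (cong (λ u → eval 1 (1 ∷ u)) (sym e′))

  -- Trees under an arbitrary assignment.

  colourIn-∷ : ∀ {u v b μ} bs → μ ≢ b → colourIn (stage u (b ∷ bs)) μ ≡ colourIn (stage v bs) μ
  colourIn-∷ {b = b} {μ} bs μ≢b rewrite dec-false (μ ≟ b) μ≢b = refl

  colourIn-head : ∀ {u b} bs → colourIn (stage u (b ∷ bs)) b ≡ black
  colourIn-head {b = b} _ rewrite dec-true (b ≟ b) refl = refl

  usedAfter : Assignment → ℕ → ℕ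
  usedAfter α n = used (after (position α) n)

  -- The index is shifted: this is the black son of node `suc n`.
  blackSon : Assignment → ℕ → ℕ
  blackSon α n = usedAfter α n + position α (suc n)

  blackSon≤used : ∀ α n → blackSon α n ≤ usedAfter α (suc n)
  blackSon≤used α n = +-monoʳ-≤ _ (proj₂ (valid α (suc n) (s≤s z≤n)))

  used<blackSon : ∀ α n → usedAfter α n < blackSon α n
  used<blackSon α n = m<m+n _ (proj₁ (valid α (suc n) (s≤s z≤n)))

  blackSon-< : ∀ α n → blackSon α n < blackSon α (suc n)
  blackSon-< α n = ≤-<-trans (blackSon≤used α n) (used<blackSon α (suc n))

  blackSon-mono : ∀ α {n k} → n ≤′ k → blackSon α n ≤ blackSon α k
  blackSon-mono α ≤′-refl     = ≤-refl
  blackSon-mono α (≤′-step q) = ≤-trans (blackSon-mono α q) (<⇒≤ (blackSon-< α _))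

  -- Black sons increase with their fathers, so those added after stage `n` all exceed `μ`.
  colourIn-stable : ∀ α {n k μ} → n ≤′ k → μ < blackSon α n →
    colourIn (after (position α) k) μ ≡ colourIn (after (position α) n) μ
  colourIn-stable α ≤′-refl     μ< = refl
  colourIn-stable α (≤′-step {k} q) μ< = trans
    (colourIn-∷ {usedAfter α (suc k)} {usedAfter α k} (blacks (after (position α) k)) (<⇒≢ (<-≤-trans μ< (blackSon-mono α q))))
    (colourIn-stable α q μ<)

  -- Nodes below the next black son of either tree have their colours settled at the common stage
  -- `n`, hence receive equally many sons in both.
  used-agree : ∀ α β {n k} → after (position α) n ≡ after (position β) n → n ≤′ k →
    k < blackSon α n → k < blackSon β n → usedAfter α k ≡ usedAfter β k
  used-agree α β e ≤′-refl             _  _  = cong used e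
  used-agree α β {n} e (≤′-step {k} q) <α <β =
    cong₂ (λ u c → u + arity c) (used-agree α β e q (<⇒≤ <α) (<⇒≤ <β)) (begin
      colourIn (after (position α) k) (suc k)   ≡⟨ colourIn-stable α q <α ⟩
      colourIn (after (position α) n) (suc k)   ≡⟨ cong (λ S → colourIn S (suc k)) e ⟩
      colourIn (after (position β) n) (suc k)   ≡⟨ colourIn-stable β q <β ⟨
      colourIn (after (position β) k) (suc k)   ∎)
    where open ≡-Reasoning

  -- The rightmost tree.

  blackSon-ρ : ∀ n → blackSon ρ n ≡ usedAfter ρ (suc n)
  blackSon-ρ n = cong (usedAfter ρ n +_) (lastPosition-isLast (suc n))

  -- Four statements by joint induction: the black nodes are the values of `σ` at positive integers,
  -- which by `carry-cases` makes each arity the step of `σ`, so that the last son, the new black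
  -- node, is again a value of `σ`.
  used-ρ   : ∀ n → usedAfter ρ n ≡ σ n
  arity-ρ  : ∀ n → arity (colour (position ρ) (suc n)) ≡ top (code n)
  black⇒σ  : ∀ n {μ} → μ ∈ blacks (after (position ρ) n) → ∃[ k ] μ ≡ σ (suc k)
  σ⇒black  : ∀ {n k} → k < n → σ (suc k) ∈ blacks (after (position ρ) n)

  -- `σ 0` is 1: the root is in use before any node is processed.
  used-ρ zero    = refl
  used-ρ (suc n) = trans (cong₂ _+_ (used-ρ n) (arity-ρ n)) (sym (σ-suc n))

  arity-ρ n with suc n ∈? blacks (after (position ρ) n) | carry-cases (code-admissible n)
  ... | yes _ | inj₂ (e , _) = sym e
  ... | no  _ | inj₁ (e , _) = sym e
  ... | yes b | inj₁ (_ , ¬carry) with k , e ← black⇒σ n b =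
    ⊥-elim (¬carry (code k) (trans (cong code e) (code-σ (suc k))))
  ... | no ¬b | inj₂ (_ , v , A , e) with code-surjective A
  ...   | k , refl = ⊥-elim (¬b (subst (_∈ blacks (after (position ρ) n)) (sym 1+n≡σ) (σ⇒black k<n)))
    where
    1+n≡σ : suc n ≡ σ (suc k)
    1+n≡σ = trans (sym (eval-code (suc n))) (cong (eval 1) e)
    -- A node is smaller than its successor, so node `suc k` has been processed before `suc n` and
    -- its black son is listed.
    k<n : k < n
    k<n = s≤s⁻¹ (<-≤-trans (n<σ (suc k)) (≤-reflexive (sym 1+n≡σ)))

  black⇒σ (suc n) (here refl) = n , trans (blackSon-ρ n) (used-ρ (suc n))
  black⇒σ (suc n) (there b)   = black⇒σ n b

  σ⇒black {suc n} (s≤s k≤n) =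
    [ (λ k<n → there (σ⇒black k<n))
    , (λ k≡n → here (trans (cong (σ ∘ suc) k≡n) (sym (trans (blackSon-ρ n) (used-ρ (suc n)))))) ]′
    (m≤n⇒m<n∨m≡n k≤n)

  σ-isSon : ∀ n → IsSonOf ρ (σ (suc n)) (suc n)
  -- The position taken is the last one.
  σ-isSon n = _ , 1≤arity (colour (position ρ) (suc n)) , ≤-refl , sym (used-ρ (suc n))

  -- The sons of `suc n` lie above `σ n` and at most at `σ (suc n)`, a range that contains no value
  -- of `σ` but its right end.
  otherSons : ∀ n μ → IsSonOf ρ μ (suc n) → μ ≢ σ (suc n) → ¬ CodeEndsWithOne μ
  otherSons n μ (i , 1≤i , i≤a , e) μ≢σ one with j , refl ← endsWithOne⇒σ one =
    σ-gap {n} j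
      (subst₂ _<_ (used-ρ n) (sym e) (m<m+n _ 1≤i))
      (≤∧≢⇒< (≤-trans (≤-reflexive e) (≤-trans (+-monoʳ-≤ _ i≤a) (≤-reflexive (used-ρ (suc n))))) μ≢σ)

  -- Uniqueness of the rightmost assignment.

  σ≤used : ∀ α → SuccessorsAreSons α → ∀ n → σ (suc n) ≤ usedAfter α (suc n)
  σ≤used α sons n with s , S , i , _ , i≤a , e ← sons (suc n) (s≤s z≤n) =
    subst (_≤ usedAfter α (suc n)) (trans (sym e) (isSuccessor⇒σ S)) (+-monoʳ-≤ _ i≤a)

  -- A top equal to `d` would make `suc k` a value of `σ` between two consecutive ones. Applied to a
  -- misplaced black son, this shows that its successor lies `x` beyond `σ k`.
  top≡x-between : ∀ {n k} → σ n < suc k → suc k < σ (suc n) → top (code k) ≡ x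
  top≡x-between {n} {k} n< <1+n with carry-cases (code-admissible k)
  ... | inj₁ (e , _) = e
  ... | inj₂ (_ , v , A , e) with code-surjective A
  ...   | j , refl = ⊥-elim (σ-gap {n} (suc j)
          (<-≤-trans n< (≤-reflexive 1+k≡σ)) (≤-<-trans (≤-reflexive (sym 1+k≡σ)) <1+n))
    where
    1+k≡σ : suc k ≡ σ (suc j)
    1+k≡σ = trans (sym (eval-code (suc k))) (cong (eval 1) e)

  position-last : ∀ α → SuccessorsAreSons α → ∀ n →
    after (position α) n ≡ after (position ρ) n →
    ¬ (position α (suc n) < arity (colour (position α) (suc n)))
  position-last α sons n e pos< = go (blackSon α n) refl
    where
    open ≤-Reasoning
    -- The black son is positive; written `suc k`, it is processed at stage `k`.
    go : ∀ b → blackSon α n ≡ b → ⊥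
    go zero    eb = n≮0 (<-≤-trans (used<blackSon α n) (≤-reflexive eb))
    go (suc k) eb = <⇒≱ short (σ≤used α sons k)
      where
      used≡σ : usedAfter α n ≡ σ n
      used≡σ = trans (cong used e) (used-ρ n)

      n<b : σ n < suc k
      n<b = subst₂ _<_ used≡σ eb (used<blackSon α n)

      b< : suc k < σ (suc n)
      b< = begin-strict
        suc k                                                 ≡⟨ eb ⟨
        usedAfter α n + position α (suc n)                    <⟨ +-monoʳ-< _ pos< ⟩
        -- The position 0 is a dummy: the count of used integers does not depend on it.
        used (step (suc n) 0 (after (position α) n))          ≡⟨ cong (used ∘ step (suc n) 0) e ⟩
        usedAfter ρ (suc n)                                   ≡⟨ used-ρ (suc n) ⟩
        σ (suc n)                                             ∎

      n<k : n < k
      n<k = s≤s⁻¹ (≤-trans (s≤s (n<σ n)) n<b)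

      -- All nodes up to `k` precede the black son of `suc n` in both trees.
      used≡ : usedAfter α k ≡ σ k
      used≡ = trans (used-agree α ρ e (≤⇒≤′ (<⇒≤ n<k)) (≤-reflexive (sym eb))
        (<-≤-trans (<⇒≤ b<) (≤-reflexive (sym (trans (blackSon-ρ n) (used-ρ (suc n)))))))
        (used-ρ k)

      isBlack : colour (position α) (suc k) ≡ black
      isBlack = trans
        (colourIn-stable α (≤⇒≤′ n<k) (≤-<-trans (≤-reflexive (sym eb)) (blackSon-< α n)))
        (subst (λ b → colourIn (after (position α) (suc n)) b ≡ black) eb
          (colourIn-head {u = usedAfter α (suc n)} (blacks (after (position α) n))))

      short : usedAfter α (suc k) < σ (suc k)
      short = begin-strict
        usedAfter α (suc k)    ≡⟨ cong₂ (λ u c → u + arity c) used≡ isBlack ⟩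
        σ k + d                <⟨ +-monoʳ-< (σ k) d<x ⟩
        σ k + x                ≡⟨ cong (σ k +_) (top≡x-between {n} n<b b<) ⟨
        σ k + top (code k)     ≡⟨ σ-suc k ⟨
        σ (suc k)              ∎

  -- Equal stages give node `suc n` the same colour, hence the same last position, and
  -- `position-last` excludes an earlier one.
  position-unique : ∀ α → SuccessorsAreSons α → ∀ n →
    after (position α) n ≡ after (position ρ) n →
    position α (suc n) ≡ position ρ (suc n)
  position-unique α sons n e with m≤n⇒m<n∨m≡n (proj₂ (valid α (suc n) (s≤s z≤n)))
  ... | inj₁ pos<  = ⊥-elim (position-last α sons n e pos<)
  ... | inj₂ pos≡  = trans pos≡
    (trans (cong (λ S → arity (colourIn S (suc n))) e) (sym (lastPosition-isLast (suc n))))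

  after-unique : ∀ α → SuccessorsAreSons α → ∀ n →
    after (position α) n ≡ after (position ρ) n
  after-unique α sons zero    = refl
  after-unique α sons (suc n) =
    cong₂ (step (suc n)) (position-unique α sons n e) e
    where e = after-unique α sons n

theorem9 : (p : ℕ) (5≤p : 5 ≤ p) →
    let open Metallic p 5≤p in
    (∀ ν → 1 ≤ ν →
    ∃[ s ] IsSuccessor ν s × IsSonOf ρ s ν
    × (∀ μ → IsSonOf ρ μ ν → μ ≢ s → ¬ CodeEndsWithOne μ))
    × SuccessorsAreSons ρ
    × (∀ (α : Assignment) → SuccessorsAreSons α →
    ∀ ν → 1 ≤ ν → position α ν ≡ position ρ ν)
theorem9 p 5≤p =
    (λ { (suc n) _ → σ (suc n) , σ-isSuccessor (suc n) , σ-isSon n , otherSons n })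
  , (λ { (suc n) _ → σ (suc n) , σ-isSuccessor (suc n) , σ-isSon n })
  , (λ { α sons (suc n) _ → position-unique α sons n (after-unique α sons n) })
  where open Rightmost p 5≤p
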